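{- Let $k\geq 2$ be an even integer and let $x\in\{k-2,k\}$. Then the complete bipartite graph $K_{k-1,x}$ admits a $P_k$-decomposition.
   Context: $P_k$ denotes the path with $k$ vertices and $k-1$ edges. $K_{m,n}$ is the complete bipartite graph with parts of size $m$ and $n$. A $\Gamma$-decomposition of a graph $K$ is a set of subgraphs of $K$, each isomorphic to $\Gamma$, whose edge sets partition the edge set of $K$. -}

module Defs where

open import Data.Empty using (⊥)
open import Data.Fin using (Fin; toℕ)
open import Data.Nat using (ℕ; suc)
open import Data.Nat.Properties using (1+n≢n)
open import Data.Product using (Σ; ∃; ∃₂; _×_; proj₁; proj₂)
open import Data.Sum using (_⊎_; inj₁; inj₂; swap)
open import Data.Unit using (⊤; tt)
open import Function.Bundles using (_↔_; _⇔_; module Inverse)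
open import Level using (0ℓ)
open import Relation.Binary.Core using (Rel)
open import Relation.Binary.Definitions using (Symmetric)
open import Relation.Binary.PropositionalEquality using (_≡_; _≢_)
open import Relation.Nullary using (¬_)
open import Relation.Unary using (Pred; Irrelevant)

record Graph : Set₁ where
  field
    Vertex   : Set
    Adj      : Rel Vertex 0ℓ
    Adj-sym  : Symmetric Adj
    loopless : ∀ v → ¬ Adj v v

open Graph public

record _≅_ (G H : Graph) : Set where
  field
    bijection : Vertex G ↔ Vertex H
    adjacency : ∀ u v →
      Adj G u v ⇔ Adj H (Inverse.to bijection u) (Inverse.to bijection v)

record Subgraph (G : Graph) : Set₁ where
  field
    InVertices : Pred (Vertex G) 0ℓ
    -- Membership is a mere proposition, so that the vertices of the subgraph,
    -- taken as pairs of a vertex of G and a membership proof, are not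
    -- counted with multiplicity.
    irrelevant : Irrelevant InVertices
    InEdges    : Rel (Vertex G) 0ℓ
    edges-sym  : Symmetric InEdges
    edges⊆     : ∀ {u v} → InEdges u v → Adj G u v
    endpoints  : ∀ {u v} → InEdges u v → InVertices u × InVertices v

open Subgraph public

toGraph : ∀ {G} → Subgraph G → Graph
toGraph {G} H = record
  { Vertex   = Σ (Vertex G) (InVertices H)
  ; Adj      = λ u v → InEdges H (proj₁ u) (proj₁ v)
  ; Adj-sym  = edges-sym H
  ; loopless = λ v e → loopless G (proj₁ v) (edges⊆ H e)
  }

-- The set of subgraphs is given as a finite family. Since the edge sets are
-- nonempty (as blocks of a partition) and pairwise disjoint, the family has no
-- repetitions. An edge {u , v} is represented by both (u , v) and (v , u).
record Decomposition (Γ K : Graph) : Set₁ where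
  field
    size     : ℕ
    member   : Fin size → Subgraph K
    copy     : ∀ i → toGraph (member i) ≅ Γ
    nonempty : ∀ i → ∃₂ λ u v → InEdges (member i) u v
    disjoint : ∀ {i j} → i ≢ j → ∀ {u v} →
               InEdges (member i) u v → ¬ InEdges (member j) u v
    covering : ∀ {u v} → Adj K u v → ∃ λ i → InEdges (member i) u v

Path : ℕ → Graph
Path k = record
  { Vertex   = Fin k
  ; Adj      = λ i j → suc (toℕ i) ≡ toℕ j ⊎ suc (toℕ j) ≡ toℕ i
  ; Adj-sym  = swap
  ; loopless = λ { v (inj₁ e) → 1+n≢n e ; v (inj₂ e) → 1+n≢n e }
  }

Opposite : ∀ {A B : Set} → Rel (A ⊎ B) 0ℓ
Opposite (inj₁ _) (inj₁ _) = ⊥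
Opposite (inj₁ _) (inj₂ _) = ⊤
Opposite (inj₂ _) (inj₁ _) = ⊤
Opposite (inj₂ _) (inj₂ _) = ⊥

Opposite-sym : ∀ {A B : Set} → Symmetric (Opposite {A} {B})
Opposite-sym {x = inj₁ _} {y = inj₂ _} _ = tt
Opposite-sym {x = inj₂ _} {y = inj₁ _} _ = tt

CompleteBipartite : ℕ → ℕ → Graph
CompleteBipartite m n = record
  { Vertex   = Fin m ⊎ Fin n
  ; Adj      = Opposite
  ; Adj-sym  = λ {u} {v} → Opposite-sym {x = u} {y = v}
  ; loopless = λ { (inj₁ _) () ; (inj₂ _) () }
  }

{-# OPTIONS --safe #-}
-- Let k = 2(h + 1) and x ∈ {2h, 2h + 2}. Name the k − 1 = 1 + 2h vertices of the
-- first part ∞ and a(i,ε) with i < h and ε ∈ {0,1}, and identify the second part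
-- with ℤ/x. For s ∈ ℤ/x with parity ε take the path
--   ∞, s, a(0,ε), s + 1, a(1,ε), s + 2, …, a(h−1,ε), s + h.
-- Its vertices are distinct because h < x unless x = 0. The edge ∞b lies on the
-- path of s = b only, and a(i,ε)b only on that of the one s ∈ {b − i, b − i − 1}
-- with parity ε; parity makes sense modulo x as x is even.
module Submission where

open import Defs
open import Axiom.UniquenessOfIdentityProofs using (UIP; module Decidable⇒UIP)
open import Data.Empty using (⊥)
open import Data.Fin using (Fin; zero; suc; toℕ; fromℕ; inject₁; combine; remQuot; opposite)
open import Data.Fin.Patterns using (0F; 1F)
import Data.Fin.Properties as Fin
open import Data.Fin.Relation.Unary.Top using (view; ‵fromℕ; ‵inject₁; view-fromℕ; view-inject₁)
open import Data.Nat using (ℕ; zero; suc; _+_; _*_; _∸_; _≤_; _<_; s≤s)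
open import Data.Nat.Divisibility using (_∣_; divides)
open import Data.Nat.DivMod using (_%_; [m+kn]%n≡m%n; m<n⇒m%n≡m)
open import Data.Nat.Properties using
  (+-comm; +-suc; +-identityʳ; +-cancelˡ-≡; *-cancelˡ-≡; suc-injective;
   even≢odd; m≤m*n; ≤-trans)
open import Data.Nat.Tactic.RingSolver using (solve-∀)
open import Data.Product using (∃; ∃₂; _×_; _,_; proj₁; proj₂)
open import Data.Sum using (_⊎_; inj₁; inj₂; swap)
open import Data.Sum.Properties using (≡-dec; inj₁-injective; inj₂-injective)
open import Function.Base using (_∘_)
open import Function.Bundles using (mk↔ₛ′; mk⇔; module Equivalence)
open import Function.Definitions using (Injective)
open import Function.Endo.Propositional using (_^_)
open import Function.Properties.Inverse using (↔-trans)
open import Relation.Binary.PropositionalEquality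
open import Relation.Nullary using (yes; no; contradiction)

-- Decompositions from families of embeddings

-- The two halves of a partition are encoded by `owner`: `owned` says that any copy containing an
-- edge is its owner, which gives disjointness, and `covered` says that the owner does contain it.
embeddings⇒decomposition :
  (Γ K : Graph) → UIP (Vertex K) → (∃₂ λ p q → Adj Γ p q) →
  (n : ℕ) (φ : Fin n → Vertex Γ → Vertex K) (owner : ∀ u v → Adj K u v → Fin n) →
  (∀ s → Injective _≡_ _≡_ (φ s)) →
  (∀ s {p q} → Adj Γ p q → Adj K (φ s p) (φ s q)) →
  (∀ s {p q} → Adj Γ p q → ∀ e → owner (φ s p) (φ s q) e ≡ s) →
  (∀ {u v} e → ∃₂ λ p q →
    Adj Γ p q × φ (owner u v e) p ≡ u × φ (owner u v e) q ≡ v) →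
  Decomposition Γ K
embeddings⇒decomposition Γ K uip (p₀ , q₀ , e₀) n φ owner inj hom owned covered = record
  { size     = n
  ; member   = image
  ; copy     = λ s → record
    { bijection = mk↔ₛ′ (λ { (_ , p , _) → p }) (λ p → φ s p , p , refl)
                    (λ _ → refl) (λ { (_ , _ , refl) → refl })
    ; adjacency = λ { (_ , _ , refl) (_ , _ , refl) → mk⇔
        (λ { (_ , _ , e , eq , eq′) → subst₂ (Adj Γ) (inj s eq) (inj s eq′) e })
        (λ e → _ , _ , e , refl , refl) }
    }
  ; nonempty = λ _ → _ , _ , p₀ , q₀ , e₀ , refl , refl
  -- Both uses of `owned′` take the same adjacency proof, so `i` and `j` equal one and the same
  -- value of `owner`.
  ; disjoint = λ {i} {j} i≢j e e′ →
      i≢j (trans (sym (owned′ i e (edges⊆ (image i) e))) (owned′ j e′ (edges⊆ (image i) e)))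
  ; covering = λ e → _ , covered e
  }
  where
  image : Fin n → Subgraph K
  image s = record
    { InVertices = λ v → ∃ λ p → φ s p ≡ v
    -- A fibre of `φ s` has at most one point by injectivity, and `uip` identifies the equality
    -- proofs.
    ; irrelevant = λ { (p , refl) (q , eq) → irr (inj s eq) eq }
    ; InEdges    = λ u v → ∃₂ λ p q → Adj Γ p q × φ s p ≡ u × φ s q ≡ v
    ; edges-sym  = λ { (p , q , e , eq , eq′) → q , p , Adj-sym Γ e , eq′ , eq }
    ; edges⊆     = λ { (_ , _ , e , refl , refl) → hom s e }
    ; endpoints  = λ { (p , q , _ , eq , eq′) → (p , eq) , (q , eq′) }
    }
    where
    irr : ∀ {p q} → q ≡ p → (eq : φ s q ≡ φ s p) → (p , refl) ≡ (q , eq)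
    irr refl eq = cong (_ ,_) (uip refl eq)

  owned′ : ∀ s {u v} → InEdges (image s) u v → ∀ e → owner u v e ≡ s
  owned′ s (_ , _ , e , refl , refl) = owned s e

-- Transport along isomorphisms, and the path as a zigzag

≅-trans : ∀ {F G H} → F ≅ G → G ≅ H → F ≅ H
≅-trans F≅G G≅H = record
  { bijection = ↔-trans F.bijection G.bijection
  ; adjacency = λ u v → mk⇔
      (Equivalence.to (G.adjacency _ _) ∘ Equivalence.to (F.adjacency u v))
      (Equivalence.from (F.adjacency u v) ∘ Equivalence.from (G.adjacency _ _))
  }
  where
  module F = _≅_ F≅G
  module G = _≅_ G≅H

decomposition-resp-≅ : ∀ {Γ Δ K} → Γ ≅ Δ → Decomposition Γ K → Decomposition Δ K
decomposition-resp-≅ Γ≅Δ D = record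
  { size     = size
  ; member   = member
  ; copy     = λ i → ≅-trans (copy i) Γ≅Δ
  ; nonempty = nonempty
  ; disjoint = disjoint
  ; covering = covering
  }
  where open Decomposition D

-- Says that the positions 2i and 2j + 1 on a path are consecutive.
Step : ∀ {m} → Fin m → Fin m → Set
Step i j = toℕ i ≡ toℕ j ⊎ toℕ i ≡ suc (toℕ j)

-- The path inj₁ 0, inj₂ 0, inj₁ 1, inj₂ 1, …, with its bipartition made explicit.
Zigzag : ℕ → Graph
Zigzag m = record
  { Vertex   = Fin m ⊎ Fin m
  ; Adj      = _~_
  ; Adj-sym  = λ {u} {v} → ~-sym u v
  ; loopless = λ { (inj₁ _) () ; (inj₂ _) () }
  }
  where
  _~_ : Fin m ⊎ Fin m → Fin m ⊎ Fin m → Set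
  inj₁ i ~ inj₂ j = Step i j
  inj₂ j ~ inj₁ i = Step i j
  inj₁ _ ~ inj₁ _ = ⊥
  inj₂ _ ~ inj₂ _ = ⊥

  ~-sym : ∀ u v → u ~ v → v ~ u
  ~-sym (inj₁ _) (inj₂ _) e = e
  ~-sym (inj₂ _) (inj₁ _) e = e

Zigzag≅Path : ∀ m → Zigzag m ≅ Path (m * 2)
Zigzag≅Path m = record
  { bijection = mk↔ₛ′ to (from ∘ remQuot 2) to∘from from∘to
  ; adjacency = λ u v → mk⇔ (adj→ u v) (adj← u v)
  }
  where
  to : Fin m ⊎ Fin m → Fin (m * 2)
  to (inj₁ i) = combine i 0F
  to (inj₂ i) = combine i 1F

  from : Fin m × Fin 2 → Fin m ⊎ Fin m
  from (i , 0F) = inj₁ i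
  from (i , 1F) = inj₂ i

  to∘from′ : ∀ c → to (from c) ≡ combine (proj₁ c) (proj₂ c)
  to∘from′ (_ , 0F) = refl
  to∘from′ (_ , 1F) = refl

  to∘from : ∀ c → to (from (remQuot 2 c)) ≡ c
  to∘from c = trans (to∘from′ (remQuot 2 c)) (Fin.combine-remQuot {m} 2 c)

  from∘to : ∀ v → from (remQuot 2 (to v)) ≡ v
  from∘to (inj₁ i) = cong from (Fin.remQuot-combine i 0F)
  from∘to (inj₂ i) = cong from (Fin.remQuot-combine i 1F)

  position₁ : ∀ i → toℕ (to (inj₁ i)) ≡ 2 * toℕ i
  position₁ i = trans (Fin.toℕ-combine i 0F) (+-identityʳ _)

  position₂ : ∀ i → toℕ (to (inj₂ i)) ≡ suc (2 * toℕ i)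
  position₂ i = trans (Fin.toℕ-combine i 1F) (+-comm _ 1)

  2*suc : ∀ n → suc (suc (2 * n)) ≡ 2 * suc n
  2*suc n = cong suc (sym (+-suc n (n + 0)))

  step→ : ∀ i j → Step i j → Adj (Path (m * 2)) (to (inj₁ i)) (to (inj₂ j))
  step→ i j (inj₁ i≡j) rewrite position₁ i | position₂ j | i≡j = inj₁ refl
  step→ i j (inj₂ i≡1+j) rewrite position₁ i | position₂ j | i≡1+j = inj₂ (2*suc (toℕ j))

  step← : ∀ i j → Adj (Path (m * 2)) (to (inj₁ i)) (to (inj₂ j)) → Step i j
  step← i j e rewrite position₁ i | position₂ j with e
  ... | inj₁ eq = inj₁ (*-cancelˡ-≡ _ _ 2 (suc-injective eq))
  ... | inj₂ eq = inj₂ (*-cancelˡ-≡ _ _ 2 (trans (sym eq) (2*suc (toℕ j))))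

  adj→ : ∀ u v → Adj (Zigzag m) u v → Adj (Path (m * 2)) (to u) (to v)
  adj→ (inj₁ i) (inj₂ j) e = step→ i j e
  adj→ (inj₂ j) (inj₁ i) e = swap (step→ i j e)

  adj← : ∀ u v → Adj (Path (m * 2)) (to u) (to v) → Adj (Zigzag m) u v
  adj← (inj₁ i) (inj₂ j) e = step← i j e
  adj← (inj₂ j) (inj₁ i) e = step← i j (swap e)
  -- Vertices of one class have positions of equal parity, which cannot be consecutive.
  adj← (inj₁ i) (inj₁ j) e rewrite position₁ i | position₁ j with e
  ... | inj₁ eq = contradiction (sym eq) (even≢odd (toℕ j) (toℕ i))
  ... | inj₂ eq = contradiction (sym eq) (even≢odd (toℕ i) (toℕ j))
  adj← (inj₂ i) (inj₂ j) e rewrite position₂ i | position₂ j with e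
  ... | inj₁ eq = contradiction (sym (suc-injective eq)) (even≢odd (toℕ j) (toℕ i))
  ... | inj₂ eq = contradiction (sym (suc-injective eq)) (even≢odd (toℕ i) (toℕ j))

-- With the bipartition explicit, each edge need only be treated as a pair in `Fin p` and `Fin q`;
-- the reversed orientation follows by symmetry.
zigzags⇒decomposition :
  ∀ {m n p q} (α : Fin n → Fin (suc m) → Fin p) (β : Fin n → Fin (suc m) → Fin q)
  (owner : Fin p → Fin q → Fin n) →
  (∀ s → Injective _≡_ _≡_ (α s)) → (∀ s → Injective _≡_ _≡_ (β s)) →
  (∀ s i j → Step i j → owner (α s i) (β s j) ≡ s) →
  (∀ a b → ∃₂ λ i j → Step i j × α (owner a b) i ≡ a × β (owner a b) j ≡ b) →
  Decomposition (Path (suc m * 2)) (CompleteBipartite p q)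
zigzags⇒decomposition {m} {n} {p} {q} α β owner α-inj β-inj owned covered =
  decomposition-resp-≅ (Zigzag≅Path (suc m))
    (embeddings⇒decomposition (Zigzag (suc m)) (CompleteBipartite p q)
      (Decidable⇒UIP.≡-irrelevant (≡-dec Fin._≟_ Fin._≟_))
      (inj₁ zero , inj₂ zero , inj₁ refl) n φ owner′ φ-inj
      (λ s {u} {v} → hom s u v) (λ s {u} {v} → owned′ s u v) (λ {u} {v} → covered′ u v))
  where
  V = Fin p ⊎ Fin q

  φ : Fin n → Fin (suc m) ⊎ Fin (suc m) → V
  φ s (inj₁ i) = inj₁ (α s i)
  φ s (inj₂ j) = inj₂ (β s j)

  φ-inj : ∀ s → Injective _≡_ _≡_ (φ s)
  φ-inj s {inj₁ _} {inj₁ _} eq = cong inj₁ (α-inj s (inj₁-injective eq))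
  φ-inj s {inj₂ _} {inj₂ _} eq = cong inj₂ (β-inj s (inj₂-injective eq))

  hom : ∀ s u v → Adj (Zigzag (suc m)) u v → Opposite (φ s u) (φ s v)
  hom s (inj₁ _) (inj₂ _) _ = _
  hom s (inj₂ _) (inj₁ _) _ = _

  owner′ : ∀ u v → Opposite u v → Fin n
  owner′ (inj₁ a) (inj₂ b) _ = owner a b
  owner′ (inj₂ b) (inj₁ a) _ = owner a b

  owned′ : ∀ s u v → Adj (Zigzag (suc m)) u v → ∀ e → owner′ (φ s u) (φ s v) e ≡ s
  owned′ s (inj₁ i) (inj₂ j) step _ = owned s i j step
  owned′ s (inj₂ j) (inj₁ i) step _ = owned s i j step

  covered′ : ∀ u v e → ∃₂ λ p q →
    Adj (Zigzag (suc m)) p q × φ (owner′ u v e) p ≡ u × φ (owner′ u v e) q ≡ v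
  covered′ (inj₁ a) (inj₂ b) _ with covered a b
  ... | i , j , step , eq , eq′ = inj₁ i , inj₂ j , step , cong inj₁ eq , cong inj₂ eq′
  covered′ (inj₂ b) (inj₁ a) _ with covered a b
  ... | i , j , step , eq , eq′ = inj₂ j , inj₁ i , step , cong inj₂ eq′ , cong inj₁ eq

-- Rotation of `Fin n` as addition in ℤ/n

private variable
  n : ℕ

rotate : Fin n → Fin n
rotate {suc n} i with view i
... | ‵fromℕ     = zero
... | ‵inject₁ j = suc j

unrotate : Fin n → Fin n
unrotate zero    = fromℕ _
unrotate (suc i) = inject₁ i

rotate-unrotate : (i : Fin n) → rotate (unrotate i) ≡ i
rotate-unrotate {suc n} zero    rewrite view-fromℕ n   = refl
rotate-unrotate {suc n} (suc i) rewrite view-inject₁ i = refl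

unrotate-rotate : (i : Fin n) → unrotate (rotate i) ≡ i
unrotate-rotate {suc n} i with view i
... | ‵fromℕ     = refl
... | ‵inject₁ _ = refl

^-comm : ∀ {A : Set} (f : A → A) d x → _^_ A f d (f x) ≡ f (_^_ A f d x)
^-comm f zero    x = refl
^-comm f (suc d) x = cong f (^-comm f d x)

^-inverse : ∀ {A : Set} {f g : A → A} → (∀ x → f (g x) ≡ x) →
  ∀ d x → _^_ A f d (_^_ A g d x) ≡ x
^-inverse {f = f} {g} fg zero    x = refl
^-inverse {f = f} {g} fg (suc d) x =
  trans (sym (^-comm f d _)) (trans (cong (_^_ _ f d) (fg _)) (^-inverse fg d x))

rotations unrotations : ℕ → Fin n → Fin n
rotations   d = _^_ _ rotate d
unrotations d = _^_ _ unrotate d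

rotations-unrotations : ∀ d (i : Fin n) → rotations d (unrotations d i) ≡ i
rotations-unrotations = ^-inverse rotate-unrotate

unrotations-rotations : ∀ d (i : Fin n) → unrotations d (rotations d i) ≡ i
unrotations-rotations = ^-inverse unrotate-rotate

-- A congruence modulo `n` with explicit quotient: `q` is 1 exactly when the rotation wraps around.
toℕ-rotate : (i : Fin n) → ∃ λ q → toℕ (rotate i) + q * n ≡ suc (toℕ i)
toℕ-rotate {suc n} i with view i
... | ‵fromℕ     = 1 , trans (+-identityʳ _) (cong suc (sym (Fin.toℕ-fromℕ n)))
... | ‵inject₁ j = 0 , trans (+-identityʳ _) (cong suc (sym (Fin.toℕ-inject₁ j)))

toℕ-rotations : ∀ d (i : Fin n) → ∃ λ q → toℕ (rotations d i) + q * n ≡ d + toℕ i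
toℕ-rotations zero i = 0 , +-identityʳ _
toℕ-rotations {n} (suc d) i with toℕ-rotations d i | toℕ-rotate (rotations d i)
... | q , eq | r , eq′ = r + q , (begin
  a + (r + q) * n      ≡⟨ lemma a r q n ⟩
  (a + r * n) + q * n  ≡⟨ cong (_+ q * n) eq′ ⟩
  suc (b + q * n)      ≡⟨ cong suc eq ⟩
  suc (d + toℕ i)      ∎)
  where
  open ≡-Reasoning
  a = toℕ (rotations (suc d) i)
  b = toℕ (rotations d i)
  lemma : ∀ a r q n → a + (r + q) * n ≡ (a + r * n) + q * n
  lemma = solve-∀

-- A common endpoint makes c + i and d + i congruent modulo `n`, and numbers below `n` are their own
-- residues.
rotations-injective : ∀ {c d} (i : Fin n) → c < n → d < n → rotations c i ≡ rotations d i → c ≡ d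
rotations-injective {n@(suc _)} {c} {d} i c<n d<n eq
  with toℕ-rotations c i | toℕ-rotations d i
... | q , eq₁ | r , eq₂ rewrite eq = begin
  c                ≡⟨ m<n⇒m%n≡m c<n ⟨
  c % n            ≡⟨ [m+kn]%n≡m%n c r n ⟨
  (c + r * n) % n  ≡⟨ cong (_% n) (+-cancelˡ-≡ (a + toℕ i) _ _ shifted) ⟩
  (d + q * n) % n  ≡⟨ [m+kn]%n≡m%n d q n ⟩
  d % n            ≡⟨ m<n⇒m%n≡m d<n ⟩
  d                ∎
  where
  open ≡-Reasoning
  a = toℕ (rotations d i)
  lemma : ∀ a i c r → a + i + (c + r) ≡ (a + r) + (c + i)
  lemma = solve-∀
  -- Adding the two congruences crosswise avoids subtraction in ℕ.
  shifted : a + toℕ i + (c + r * n) ≡ a + toℕ i + (d + q * n)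
  shifted = begin
    a + toℕ i + (c + r * n)    ≡⟨ lemma a (toℕ i) c (r * n) ⟩
    (a + r * n) + (c + toℕ i)  ≡⟨ cong₂ _+_ eq₂ (sym eq₁) ⟩
    (d + toℕ i) + (a + q * n)  ≡⟨ +-comm (d + toℕ i) _ ⟩
    (a + q * n) + (d + toℕ i)  ≡⟨ lemma a (toℕ i) d (q * n) ⟨
    a + toℕ i + (d + q * n)    ∎

-- Parity

bit : ℕ → Fin 2
bit zero    = 0F
bit (suc n) = opposite (bit n)

bit-*2 : ∀ m → bit (m * 2) ≡ 0F
bit-*2 zero    = refl
bit-*2 (suc m) rewrite bit-*2 m = refl

opposite≢ : (e : Fin 2) → opposite e ≢ e
opposite≢ 0F ()
opposite≢ 1F ()

opposite-≢⇒≡ : (e f : Fin 2) → opposite e ≢ f → e ≡ f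
opposite-≢⇒≡ 0F 0F _ = refl
opposite-≢⇒≡ 0F 1F p = contradiction refl p
opposite-≢⇒≡ 1F 0F p = contradiction refl p
opposite-≢⇒≡ 1F 1F _ = refl

bit-rotate : bit n ≡ 0F → (i : Fin n) → bit (toℕ (rotate i)) ≡ opposite (bit (toℕ i))
bit-rotate {suc n} even i with view i
-- The wrap to 0 flips parity only because the modulus `suc n` is even.
... | ‵fromℕ     rewrite Fin.toℕ-fromℕ n   = sym even
... | ‵inject₁ j rewrite Fin.toℕ-inject₁ j = refl

-- The rotated paths

-- Asking for the bound only when `Fin x` is inhabited admits `x = 0`, where the family of paths is
-- empty.
bipartite-decomposition : ∀ h x → bit x ≡ 0F → (Fin x → h < x) →
  Decomposition (Path (suc h * 2)) (CompleteBipartite (suc (h * 2)) x)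
bipartite-decomposition h x even h<x =
  zigzags⇒decomposition α β owner α-inj β-inj owned covered
  where
  parity : Fin x → Fin 2
  parity s = bit (toℕ s)

  α : Fin x → Fin (suc h) → Fin (suc (h * 2))
  α s zero    = zero
  α s (suc i) = suc (combine i (parity s))

  β : Fin x → Fin (suc h) → Fin x
  β s j = rotations (toℕ j) s

  -- Chooses between s and s - 1, which have opposite parities, the one of parity `e`.
  adjust : Fin 2 → Fin x → Fin x
  adjust e s with parity s Fin.≟ e
  ... | yes _ = s
  ... | no  _ = unrotate s

  ownerᶜ : Fin h × Fin 2 → Fin x → Fin x
  ownerᶜ (i , e) b = adjust e (unrotations (toℕ i) b)

  owner : Fin (suc (h * 2)) → Fin x → Fin x
  owner zero    b = b
  owner (suc c) b = ownerᶜ (remQuot 2 c) b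

  α-inj : ∀ s → Injective _≡_ _≡_ (α s)
  α-inj s {zero}  {zero}  _  = refl
  α-inj s {suc i} {suc j} eq =
    cong suc (Fin.combine-injectiveˡ i (parity s) j (parity s) (Fin.suc-injective eq))

  β-inj : ∀ s → Injective _≡_ _≡_ (β s)
  β-inj s {i} {j} eq = Fin.toℕ-injective (rotations-injective s (bound i) (bound j) eq)
    where
    bound : ∀ i → toℕ i < x
    bound i = ≤-trans (Fin.toℕ<n i) (h<x s)

  adjust-parity : ∀ s → adjust (parity s) s ≡ s
  adjust-parity s with parity s Fin.≟ parity s
  ... | yes _ = refl
  ... | no ¬p = contradiction refl ¬p

  adjust-rotate : ∀ s → adjust (parity s) (rotate s) ≡ s
  adjust-rotate s with parity (rotate s) Fin.≟ parity s
  ... | yes p = contradiction (trans (sym (bit-rotate even s)) p) (opposite≢ _)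
  ... | no _  = unrotate-rotate s

  ownedᶜ : ∀ s i j → Step (suc i) j → ownerᶜ (i , parity s) (β s j) ≡ s
  -- Here the neighbour is s + i + 1, just after a(i,ε). Going back `i` places gives s + 1, of the
  -- wrong parity, so `adjust` takes the last step back to s.
  ownedᶜ s i j (inj₁ eq) rewrite sym eq = begin
    adjust (parity s) (unrotations d (rotations (suc d) s))
      ≡⟨ cong (adjust (parity s) ∘ unrotations d) (^-comm rotate d s) ⟨
    adjust (parity s) (unrotations d (rotations d (rotate s)))
      ≡⟨ cong (adjust (parity s)) (unrotations-rotations d (rotate s)) ⟩
    adjust (parity s) (rotate s)
      ≡⟨ adjust-rotate s ⟩
    s ∎
    where
    open ≡-Reasoning
    d = toℕ i
  -- Here the neighbour is s + i, just before a(i,ε), and going back `i` places already gives s.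
  ownedᶜ s i j (inj₂ eq) rewrite sym (suc-injective eq) =
    trans (cong (adjust (parity s)) (unrotations-rotations (toℕ i) s)) (adjust-parity s)

  owned : ∀ s i j → Step i j → owner (α s i) (β s j) ≡ s
  owned s zero    zero    _ = refl
  owned s zero    (suc _) (inj₁ ())
  owned s zero    (suc _) (inj₂ ())
  owned s (suc i) j       step =
    trans (cong (λ c → ownerᶜ c (β s j)) (Fin.remQuot-combine i (parity s))) (ownedᶜ s i j step)

  Covers : Fin (suc (h * 2)) → Fin x → Fin x → Set
  Covers a b s = ∃₂ λ i j → Step i j × α s i ≡ a × β s j ≡ b

  coveredᶜ : ∀ i e b → Covers (suc (combine i e)) b (ownerᶜ (i , e) b)
  coveredᶜ i e b with parity (unrotations (toℕ i) b) Fin.≟ e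
  -- The owner is b - i, so `b` is entered just before a(i,e).
  ... | yes p = suc i , inject₁ i , inj₂ (cong suc (sym (Fin.toℕ-inject₁ i)))
    , cong (suc ∘ combine i) p
    , trans (cong (λ d → rotations d (unrotations (toℕ i) b)) (Fin.toℕ-inject₁ i))
            (rotations-unrotations (toℕ i) b)
  -- The owner is b - i - 1, so `b` comes just after a(i,e). Its parity is `e` because that of b - i
  -- is not.
  ... | no ¬p = suc i , suc i , inj₁ refl
    , cong (suc ∘ combine i) (opposite-≢⇒≡ _ e (¬p ∘ trans parity-s))
    , rotations-unrotations (suc (toℕ i)) b
    where
    s = unrotations (toℕ i) b
    parity-s : parity s ≡ opposite (parity (unrotate s))
    parity-s = trans (cong parity (sym (rotate-unrotate s))) (bit-rotate even (unrotate s))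

  covered : ∀ a b → Covers a b (owner a b)
  covered zero    b = zero , zero , inj₁ refl , refl , refl
  -- Only the vertex is transported; the owner already has the required form.
  covered (suc c) b = subst (λ c′ → Covers (suc c′) b (ownerᶜ (remQuot 2 c) b))
    (Fin.combine-remQuot {h} 2 c) (coveredᶜ (proj₁ (remQuot 2 c)) (proj₂ (remQuot {h} 2 c)) b)

proposition2p1 : ∀ (k x : ℕ) → 2 ≤ k → 2 ∣ k → x ≡ k ∸ 2 ⊎ x ≡ k →
    Decomposition (Path k) (CompleteBipartite (k ∸ 1) x)
-- Writing k as `suc h * 2` makes k - 1 and k - 2 compute to `suc (h * 2)` and `h * 2`; the quotient
-- 0 contradicts 2 ≤ k.
proposition2p1 _ _ () (divides zero refl) _
proposition2p1 _ _ _ (divides (suc h) refl) (inj₁ refl) =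
  bipartite-decomposition h (h * 2) (bit-*2 h) (h<h*2 h)
  where
  -- The inequality fails at h = 0, but there `Fin (h * 2)` is empty.
  h<h*2 : ∀ h → Fin (h * 2) → h < h * 2
  h<h*2 (suc h) _ = s≤s (s≤s (m≤m*n h 2))
proposition2p1 _ _ _ (divides (suc h) refl) (inj₂ refl) =
  bipartite-decomposition h (suc h * 2) (bit-*2 (suc h)) (λ _ → m≤m*n (suc h) 2)
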